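{- A digraph $D$ of order $n$ is minimally strong subgraph $(2,n-2)$-arc-connected if and only if $D$ is obtained from the complete digraph $\overleftrightarrow{K}_n$ by deleting an arc set $M$ such that $\overleftrightarrow{K}_n[M]$ is a union of vertex-disjoint cycles which cover all but at most one vertex of $\overleftrightarrow{K}_n$.
   Context: Digraphs are finite, without loops or parallel arcs; cycles are directed cycles, including 2-cycles. $\overleftrightarrow{K}_n$ is the complete digraph on $n$ vertices; $\overleftrightarrow{K}_n[M]$ is the subdigraph formed by the arcs of $M$ and their end-vertices. For $S\subseteq V(D)$, $\lambda_S(D)$ is the maximum number of pairwise arc-disjoint strong subgraphs of $D$ containing $S$, and $\lambda_k(D)=\min\{\lambda_S(D): S\subseteq V(D), |S|=k\}$. $D$ is minimally strong subgraph $(k,\ell)$-arc-connected if $\lambda_k(D)\ge\ell$ but $\lambda_k(D-e)\le \ell-1$ for every arc $e$ of $D$. -}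

module Defs where

open import Data.Bool using (Bool; true; T; _∧_; not)
open import Data.Bool.Properties using (T?)
open import Data.Fin using (Fin; zero; suc; inject₁; fromℕ)
open import Data.Fin.Properties using (_≟_; any?)
open import Data.Fin.Subset using (Subset; _∈_; _⊆_; ∣_∣)
open import Data.Nat using (ℕ; suc; _≤_; _<_)
open import Data.Product using (Σ-syntax; ∃-syntax; _×_; _,_)
open import Data.Sum using (_⊎_; inj₁; inj₂)
open import Data.Vec using (tabulate)
open import Data.Vec.Properties using (lookup∘tabulate; lookup⇒[]=)
open import Function.Bundles using (_⇔_)
open import Function.Definitions using (Injective)
open import Relation.Binary.Construct.Closure.ReflexiveTransitive using (Star)
open import Relation.Binary.PropositionalEquality using (_≡_; _≢_; refl; trans; subst)
open import Relation.Nullary using (¬_; Dec; does)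
open import Relation.Nullary.Decidable using (_⊎-dec_; dec-true)

ArcSet : ℕ → Set
ArcSet n = Fin n → Fin n → Bool

Arc : ∀ {n} → ArcSet n → Fin n → Fin n → Set
Arc A u v = T (A u v)

_⊆ᴬ_ : ∀ {n} → ArcSet n → ArcSet n → Set
A ⊆ᴬ B = ∀ u v → Arc A u v → Arc B u v

ArcDisjoint : ∀ {n} → ArcSet n → ArcSet n → Set
ArcDisjoint A B = ∀ u v → ¬ (Arc A u v × Arc B u v)

record Digraph (n : ℕ) : Set where
  field
    arcs     : ArcSet n
    loopless : ∀ v → ¬ Arc arcs v v

open Digraph public

-- Pointwise, since arc sets are functions and there is no function
-- extensionality.
_≐_ : ∀ {n} → Digraph n → Digraph n → Set
D ≐ D′ = ∀ u v → arcs D u v ≡ arcs D′ u v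

private
  not-refl : ∀ {n} (v : Fin n) → ¬ T (not (does (v ≟ v)))
  not-refl v t = subst (λ b → T (not b)) (dec-true (v ≟ v) refl) t

  T-∧ˡ : ∀ {a b} → T (a ∧ b) → T a
  T-∧ˡ {true} _ = _

complete : ∀ n → Digraph n
complete n = record
  { arcs     = λ u v → not (does (u ≟ v))
  ; loopless = not-refl
  }

_─_ : ∀ {n} → Digraph n → ArcSet n → Digraph n
D ─ M = record
  { arcs     = λ u v → arcs D u v ∧ not (M u v)
  ; loopless = λ v t → loopless D v (T-∧ˡ t)
  }

singleArc : ∀ {n} → Fin n → Fin n → ArcSet n
singleArc x y u v = does (u ≟ x) ∧ does (v ≟ y)

record Subdigraph {n} (D : Digraph n) : Set where
  field
    verts  : Subset n
    arcSet : ArcSet n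
    arcs⊆  : arcSet ⊆ᴬ arcs D
    ends   : ∀ u v → Arc arcSet u v → u ∈ verts × v ∈ verts

open Subdigraph public

Strong : ∀ {n} {D : Digraph n} → Subdigraph D → Set
Strong H = ∀ u v → u ∈ verts H → v ∈ verts H → Star (Arc (arcSet H)) u v

Incident : ∀ {n} → ArcSet n → Fin n → Set
Incident M v = ∃[ w ] (Arc M v w ⊎ Arc M w v)

incident? : ∀ {n} (M : ArcSet n) (v : Fin n) → Dec (Incident M v)
incident? M v = any? λ w → T? (M v w) ⊎-dec T? (M w v)

endVertices : ∀ {n} → ArcSet n → Subset n
endVertices M = tabulate λ v → does (incident? M v)

private
  incident⇒∈ : ∀ {n} (M : ArcSet n) (v : Fin n) → Incident M v → v ∈ endVertices M
  incident⇒∈ M v i = lookup⇒[]= v (endVertices M)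
    (trans (lookup∘tabulate (λ u → does (incident? M u)) v) (dec-true (incident? M v) i))

-- D [ M ]: the arcs of M together with their end-vertices.
arcInduced : ∀ {n} (D : Digraph n) (M : ArcSet n) → M ⊆ᴬ arcs D → Subdigraph D
arcInduced D M M⊆D = record
  { verts  = endVertices M
  ; arcSet = M
  ; arcs⊆  = M⊆D
  ; ends   = λ u v a → incident⇒∈ M u (v , inj₁ a) , incident⇒∈ M v (u , inj₂ a)
  }

IsMaximum : (ℕ → Set) → ℕ → Set
IsMaximum P m = P m × (∀ m′ → P m′ → m′ ≤ m)

IsMinimum : (ℕ → Set) → ℕ → Set
IsMinimum P m = P m × (∀ m′ → P m′ → m ≤ m′)

-- m pairwise arc-disjoint strong subgraphs of D, each containing S.
record StrongPacking {n} (D : Digraph n) (S : Subset n) (m : ℕ) : Set where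
  field
    member   : Fin m → Subdigraph D
    strong   : ∀ i → Strong (member i)
    contains : ∀ i → S ⊆ verts (member i)
    disjoint : ∀ i j → i ≢ j → ArcDisjoint (arcSet (member i)) (arcSet (member j))

-- "λ_S(D) = m".
IsLambdaS : ∀ {n} → Digraph n → Subset n → ℕ → Set
IsLambdaS D S = IsMaximum (StrongPacking D S)

-- "λ_k(D) = m".
IsLambda : ∀ {n} → ℕ → Digraph n → ℕ → Set
IsLambda {n} k D = IsMinimum λ m → Σ[ S ∈ Subset n ] (∣ S ∣ ≡ k × IsLambdaS D S m)

-- The bound λ_k(D - e) ≤ ℓ - 1 is written λ_k(D - e) < ℓ, so that for ℓ = 0 it
-- is not affected by truncated subtraction (it is then unsatisfiable).
MinimallyStrongArcConnected : ∀ {n} → ℕ → ℕ → Digraph n → Set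
MinimallyStrongArcConnected k ℓ D =
  (∃[ m ] (IsLambda k D m × ℓ ≤ m)) ×
  (∀ x y → Arc (arcs D) x y → ∃[ m ] (IsLambda k (D ─ singleArc x y) m × m < ℓ))

record Cycle (n : ℕ) : Set where
  field
    -- The number of vertices is 2 + extra.
    extra     : ℕ
    vertex    : Fin (suc (suc extra)) → Fin n
    injective : Injective _≡_ _≡_ vertex

open Cycle public

OnCycle : ∀ {n} → Cycle n → Fin n → Set
OnCycle C v = ∃[ i ] (vertex C i ≡ v)

data CycleArc {n} (C : Cycle n) : Fin n → Fin n → Set where
  step  : ∀ i → CycleArc C (vertex C (inject₁ i)) (vertex C (suc i))
  close : CycleArc C (vertex C (fromℕ (suc (extra C)))) (vertex C zero)

VertexDisjoint : ∀ {n} → Cycle n → Cycle n → Set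
VertexDisjoint C C′ = ∀ v → ¬ (OnCycle C v × OnCycle C′ v)

IsUnionOf : ∀ {n} {D : Digraph n} {t} → Subdigraph D → (Fin t → Cycle n) → Set
IsUnionOf H C =
  (∀ v → v ∈ verts H ⇔ (∃[ i ] OnCycle (C i) v)) ×
  (∀ u v → Arc (arcSet H) u v ⇔ (∃[ i ] CycleArc (C i) u v))

CoverAllButAtMostOne : ∀ {n t} → (Fin t → Cycle n) → Set
CoverAllButAtMostOne C =
  ∀ u v → ¬ (∃[ i ] OnCycle (C i) u) → ¬ (∃[ i ] OnCycle (C i) v) → u ≡ v

IsAlmostSpanningDisjointCycleUnion : ∀ {n} {D : Digraph n} → Subdigraph D → Set
IsAlmostSpanningDisjointCycleUnion {n} H =
  ∃[ t ] Σ[ C ∈ (Fin t → Cycle n) ]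
    ((∀ i j → i ≢ j → VertexDisjoint (C i) (C j)) ×
     IsUnionOf H C ×
     CoverAllButAtMostOne C)

{-# OPTIONS --safe #-}
module Submission where

-- Let M be the complement of D. A packing of n − 2 strong subgraphs on a pair
-- {x , y} forces both degrees of x and y to be at least n − 2, so M has in- and
-- out-degrees at most 1. Conversely, for every such M and every pair {u , v},
-- the other n − 2 vertices w index strong subgraphs that avoid M, each the
-- union of a u→v path and a v→u path. The u→v path is u w v if possible; if
-- u w ∈ M it is the arc u v, and if w v ∈ M it is u v or, when some u a ∈ M
-- already took that arc, u w a v. All these paths are arc-disjoint because M
-- has degrees at most 1. Hence minimality says that M is a maximal arc set with
-- degrees at most 1: no arc from a vertex without out-arcs in M to a different
-- vertex without in-arcs in M can be added. That is, M is the set of arcs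
-- (x , f x) with f x ≠ x, for a permutation f with at most one fixed point.

open import Data.Bool using (T; true; false; not; _∨_)
open import Data.Bool.Properties using (T?; T-∧; T-∨)
open import Data.Empty using (⊥-elim)
open import Data.Fin using (Fin; zero; suc; toℕ; fromℕ; inject₁; punchIn; punchOut)
open import Data.Fin.Properties using (_≟_; any?; suc-injective; toℕ-injective; toℕ-inject₁; toℕ-fromℕ; toℕ<n)
open import Data.Fin.Properties using (inject₁-injective; fromℕ≢inject₁; injective⇒≤; pigeonhole)
open import Data.Fin.Properties using (punchIn-injective; punchInᵢ≢i; punchIn-punchOut)
open import Data.Fin.Relation.Unary.Top using (view; ‵fromℕ; ‵inject₁)
open import Data.Fin.Subset using (Subset; inside; outside; _∈_; _∪_; ⁅_⁆; ∣_∣)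
open import Data.Fin.Subset.Properties using (x∈⁅x⁆; x∈p∪q⁺; ∣⁅x⁆∣≡1; ∪-identityˡ; ∪-identityʳ)
open import Data.List using (List; []; _∷_; allFin)
open import Data.List.Membership.Propositional using () renaming (_∈_ to _∈ˡ_)
open import Data.List.Membership.Propositional.Properties using (∈-allFin)
open import Data.List.Relation.Unary.Any using (here; there)
open import Data.Nat using (ℕ; zero; suc; _+_; _≤_; _<_; _∸_; z≤n; s≤s)
open import Data.Nat.GeneralisedArithmetic using (fold; fold-+)
open import Data.Nat.Properties using (≤-refl; ≤-trans; ≤-pred; <⇒≤; ≰⇒>; _≤?_; <-irrefl; <-cmp; n<1+n)
open import Data.Nat.Properties using (m+[n∸m]≡n; m∸n+n≡m; m∸n≤m; m≤n+m∸n; ∸-monoˡ-≤; m≤n⇒m<n∨m≡n; +-comm; +-suc)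
open import Data.Nat.Properties using () renaming (suc-injective to ℕ-suc-injective)
open import Data.Product using (Σ-syntax; ∃-syntax; _×_; _,_; proj₁; proj₂)
open import Data.Sum using (_⊎_; inj₁; inj₂; [_,_]′)
open import Data.Vec using ([]; _∷_; here; there)
open import Data.Vec.Functional using () renaming (_∷_ to _∷ᶠ_)
open import Data.Vec.Properties using (lookup∘tabulate; []=⇒lookup)
open import Function using (_∘_)
open import Function.Bundles using (_⇔_; mk⇔; Equivalence)
open import Function.Definitions using (Injective)
open import Level using (0ℓ)
open import Relation.Binary.Construct.Closure.ReflexiveTransitive using (Star; ε; _◅_; _◅◅_)
open import Relation.Binary.Definitions using (tri<; tri≈; tri>)
open import Relation.Binary.PropositionalEquality using (_≡_; _≢_; refl; sym; trans; cong; subst)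
open import Relation.Nullary using (¬_; Dec; yes; no; does)
open import Relation.Nullary.Decidable using (_⊎-dec_; _×-dec_; map′; decidable-stable)
open import Relation.Unary using (Pred; Decidable)
open import Defs

open Equivalence using (to; from)

private
  variable
    n m k : ℕ

T-does : ∀ {a} {A : Set a} (A? : Dec A) → T (does A?) ⇔ A
T-does (yes a) = mk⇔ (λ _ → a) (λ _ → _)
T-does (no ¬a) = mk⇔ (λ ()) ¬a

-- Two-element subsets

∣S∣≡0⇒∉ : (S : Subset n) → ∣ S ∣ ≡ 0 → ∀ {z} → ¬ z ∈ S
∣S∣≡0⇒∉ (outside ∷ S) eq (there z∈S) = ∣S∣≡0⇒∉ S eq z∈S

∣S∣≡1⇒singleton : (S : Subset n) → ∣ S ∣ ≡ 1 →
                  ∃[ u ] (u ∈ S × (∀ {z} → z ∈ S → z ≡ u))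
∣S∣≡1⇒singleton (inside ∷ S) eq = zero , here , λ where
  here        → refl
  (there z∈S) → ⊥-elim (∣S∣≡0⇒∉ S (ℕ-suc-injective eq) z∈S)
∣S∣≡1⇒singleton (outside ∷ S) eq with u , u∈S , only ← ∣S∣≡1⇒singleton S eq =
  suc u , there u∈S , λ { (there z∈S) → cong suc (only z∈S) }

record Pair (S : Subset n) : Set where
  field
    u v    : Fin n
    u≢v    : u ≢ v
    u∈     : u ∈ S
    v∈     : v ∈ S
    either : ∀ {z} → z ∈ S → z ≡ u ⊎ z ≡ v

∣S∣≡2⇒Pair : (S : Subset n) → ∣ S ∣ ≡ 2 → Pair S
∣S∣≡2⇒Pair (inside ∷ S) eq with v , v∈S , only ← ∣S∣≡1⇒singleton S (ℕ-suc-injective eq) =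
  record
    { u = zero ; v = suc v ; u≢v = λ () ; u∈ = here ; v∈ = there v∈S
    ; either = λ { here → inj₁ refl ; (there z∈S) → inj₂ (cong suc (only z∈S)) } }
∣S∣≡2⇒Pair (outside ∷ S) eq =
  record
    { u = suc u ; v = suc v ; u≢v = u≢v ∘ suc-injective ; u∈ = there u∈ ; v∈ = there v∈
    ; either = λ { (there z∈S) → [ inj₁ ∘ cong suc , inj₂ ∘ cong suc ]′ (either z∈S) } }
  where open Pair (∣S∣≡2⇒Pair S eq)

∣⁅x⁆∪⁅y⁆∣≡2 : (x y : Fin n) → x ≢ y → ∣ ⁅ x ⁆ ∪ ⁅ y ⁆ ∣ ≡ 2
∣⁅x⁆∪⁅y⁆∣≡2 zero    zero    x≢y = ⊥-elim (x≢y refl)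
∣⁅x⁆∪⁅y⁆∣≡2 zero    (suc y) _   = cong suc (trans (cong ∣_∣ (∪-identityˡ ⁅ y ⁆)) (∣⁅x⁆∣≡1 y))
∣⁅x⁆∪⁅y⁆∣≡2 (suc x) zero    _   = cong suc (trans (cong ∣_∣ (∪-identityʳ ⁅ x ⁆)) (∣⁅x⁆∣≡1 x))
∣⁅x⁆∪⁅y⁆∣≡2 (suc x) (suc y) x≢y = ∣⁅x⁆∪⁅y⁆∣≡2 x y (x≢y ∘ cong suc)

-- These vertices index the members of the packing. The two `punchIn`s skip `u` and then `v`; `v′`
-- is the position of `v` once `u` is removed.
others : (u v : Fin n) → u ≢ v →
         Σ[ w ∈ (Fin (n ∸ 2) → Fin n) ] (Injective _≡_ _≡_ w × (∀ i → w i ≢ u × w i ≢ v))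
others {suc zero}    _ _ _   = (λ ()) , (λ { {()} }) , λ ()
others {suc (suc _)} u v u≢v =
  punchIn u ∘ punchIn v′ ,
  (λ eq → punchIn-injective v′ _ _ (punchIn-injective u _ _ eq)) ,
  λ i → punchInᵢ≢i u (punchIn v′ i) ,
        λ eq → punchInᵢ≢i v′ i (punchIn-injective u _ _ (trans eq (sym (punchIn-punchOut u≢v))))
  where
  v′ = punchOut u≢v

-- Strong subgraphs formed by two opposite walks

-- The arcs (x , y) of the walk from s through the vertices of the list to t.
data PathArc {n} : Fin n → List (Fin n) → Fin n → Fin n → Fin n → Set where
  single : ∀ {s t} → PathArc s [] t s t
  first  : ∀ {s p ps t} → PathArc s (p ∷ ps) t s p
  later  : ∀ {s p ps t x y} → PathArc p ps t x y → PathArc s (p ∷ ps) t x y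

pathArc? : ∀ (s : Fin n) ps t x y → Dec (PathArc s ps t x y)
pathArc? s [] t x y =
  map′ (λ { (refl , refl) → single }) (λ { single → refl , refl }) ((s ≟ x) ×-dec (t ≟ y))
pathArc? s (p ∷ ps) t x y =
  map′ (λ { (inj₁ (refl , refl)) → first ; (inj₂ a) → later a })
       (λ { first → inj₁ (refl , refl) ; (later a) → inj₂ a })
       (((s ≟ x) ×-dec (p ≟ y)) ⊎-dec pathArc? p ps t x y)

module _ {R : Fin n → Fin n → Set} where

  path⇒Star : ∀ {s} ps {t} → (∀ {x y} → PathArc s ps t x y → R x y) → Star R s t
  path⇒Star []       sub = sub single ◅ ε
  path⇒Star (p ∷ ps) sub = sub first ◅ path⇒Star ps (sub ∘ later)

  start⇒tail : ∀ {s ps t} → (∀ {x y} → PathArc s ps t x y → R x y) →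
               ∀ {x y} → PathArc s ps t x y → Star R s x
  start⇒tail sub single    = ε
  start⇒tail sub first     = ε
  start⇒tail sub (later a) = sub first ◅ start⇒tail (sub ∘ later) a

  head⇒end : ∀ {s ps t} → (∀ {x y} → PathArc s ps t x y → R x y) →
             ∀ {x y} → PathArc s ps t x y → Star R y t
  head⇒end {ps = []}     sub single    = ε
  head⇒end {ps = _ ∷ ps} sub first     = path⇒Star ps (sub ∘ later)
  head⇒end {ps = _ ∷ _}  sub (later a) = head⇒end (sub ∘ later) a

∈endVertices⇒Incident : (M : ArcSet n) {v : Fin n} → v ∈ endVertices M → Incident M v
∈endVertices⇒Incident M {v} v∈ = to (T-does (incident? M v))
  (subst T (sym (trans (sym (lookup∘tabulate (λ x → does (incident? M x)) v)) ([]=⇒lookup v∈))) _)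

module _ {n} (D : Digraph n) (u v : Fin n) (ps qs : List (Fin n)) where

  loopArc? : ∀ x y → Dec (PathArc u ps v x y ⊎ PathArc v qs u x y)
  loopArc? x y = pathArc? u ps v x y ⊎-dec pathArc? v qs u x y

  loopArcs : ArcSet n
  loopArcs x y = does (loopArc? x y)

  loop : (∀ {x y} → PathArc u ps v x y → Arc (arcs D) x y) →
         (∀ {x y} → PathArc v qs u x y → Arc (arcs D) x y) → Subdigraph D
  loop p⊆D q⊆D = arcInduced D loopArcs
    λ x y a → [ p⊆D , q⊆D ]′ (to (T-does (loopArc? x y)) a)

  module _ (p⊆D : ∀ {x y} → PathArc u ps v x y → Arc (arcs D) x y)
           (q⊆D : ∀ {x y} → PathArc v qs u x y → Arc (arcs D) x y) where

    private
      p⊆ : ∀ {x y} → PathArc u ps v x y → Arc loopArcs x y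
      p⊆ {x} {y} = from (T-does (loopArc? x y)) ∘ inj₁

      q⊆ : ∀ {x y} → PathArc v qs u x y → Arc loopArcs x y
      q⊆ {x} {y} = from (T-does (loopArc? x y)) ∘ inj₂

      u⇒v : Star (Arc loopArcs) u v
      u⇒v = path⇒Star ps p⊆

      v⇒u : Star (Arc loopArcs) v u
      v⇒u = path⇒Star qs q⊆

      -- The two walks join to one closed walk through `u`, and every arc lies on it.
      arc-linked : ∀ {x y} → Arc loopArcs x y →
                   Star (Arc loopArcs) u x × Star (Arc loopArcs) y u
      arc-linked {x} {y} a with to (T-does (loopArc? x y)) a
      ... | inj₁ p = start⇒tail p⊆ p , head⇒end p⊆ p ◅◅ v⇒u
      ... | inj₂ q = u⇒v ◅◅ start⇒tail q⊆ q , head⇒end q⊆ q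

      linked : ∀ {x} → x ∈ endVertices loopArcs →
               Star (Arc loopArcs) u x × Star (Arc loopArcs) x u
      linked x∈ with ∈endVertices⇒Incident loopArcs x∈
      ... | _ , inj₁ a = proj₁ (arc-linked a) , a ◅ proj₂ (arc-linked a)
      ... | _ , inj₂ a = proj₁ (arc-linked a) ◅◅ a ◅ ε , proj₂ (arc-linked a)

      -- Even a walk with no inner vertices has a first arc, so its start is an end-vertex of some
      -- arc. This puts `u` and `v` into the arc-induced subgraph.
      nonempty : ∀ {R : Fin n → Set} s rs {t} → (∀ {x y} → PathArc s rs t x y → R x) → R s
      nonempty _ []      f = f single
      nonempty _ (_ ∷ _) f = f first

    loop-strong : Strong (loop p⊆D q⊆D)
    loop-strong x y x∈ y∈ = proj₂ (linked x∈) ◅◅ proj₁ (linked y∈)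

    loop-∋u : u ∈ verts (loop p⊆D q⊆D)
    loop-∋u = nonempty u ps λ p → proj₁ (ends (loop p⊆D q⊆D) _ _ (p⊆ p))

    loop-∋v : v ∈ verts (loop p⊆D q⊆D)
    loop-∋v = nonempty v qs λ q → proj₁ (ends (loop p⊆D q⊆D) _ _ (q⊆ q))

-- Packings in the complement of a partial permutation

record PartialPermutation {n} (M : ArcSet n) : Set where
  field
    irreflexive : ∀ {x} → ¬ Arc M x x
    out-unique  : ∀ {x y z} → Arc M x y → Arc M x z → y ≡ z
    in-unique   : ∀ {x y z} → Arc M x z → Arc M y z → x ≡ y

module Routes {n} (M : ArcSet n) (pp : PartialPermutation M) where
  open PartialPermutation pp

  data Route (u v w : Fin n) : List (Fin n) → Set where
    direct  : Arc M u w → Route u v w []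
    direct′ : ¬ Arc M u w → Arc M w v → (∀ a → ¬ Arc M u a) → Route u v w []
    via     : ¬ Arc M u w → ¬ Arc M w v → Route u v w (w ∷ [])
    detour  : ∀ {a} → ¬ Arc M u w → Arc M w v → Arc M u a → Route u v w (w ∷ a ∷ [])

  route : ∀ u v w → ∃[ ps ] Route u v w ps
  route u v w with T? (M u w) | T? (M w v) | any? (λ a → T? (M u a))
  ... | yes uw | _      | _            = _ , direct uw
  ... | no ¬uw | no ¬wv | _            = _ , via ¬uw ¬wv
  ... | no ¬uw | yes wv | yes (_ , ua) = _ , detour ¬uw wv ua
  ... | no ¬uw | yes wv | no ¬∃        = _ , direct′ ¬uw wv λ a ua → ¬∃ (a , ua)

  -- What an arc (x , y) of the route of w says about w; it determines w.
  data Owns (u v w x y : Fin n) : Set where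
    chord  : x ≡ u → y ≡ v → Arc M u w ⊎ (Arc M w v × (∀ a → ¬ Arc M u a)) → Owns u v w x y
    start  : x ≡ u → y ≢ v → w ≡ y → Owns u v w x y
    finish : x ≢ u → y ≡ v → (w ≡ x × ¬ Arc M u x) ⊎ (Arc M w v × Arc M u x) → Owns u v w x y
    inner  : x ≢ u → y ≢ v → w ≡ x → Owns u v w x y

  module _ {u v w : Fin n} (u≢v : u ≢ v) (w≢u : w ≢ u) (w≢v : w ≢ v) where

    -- The arc `u v` is used only if the out-arc of `u` in `M` goes to `w` or does not exist. On the
    -- detour `u w a v`, having `w a` in `M` would force `w ≡ u`, and having `a v` in `M` would
    -- force `a ≡ w`, because predecessors are unique.
    route-avoids : ∀ {ps x y} → Route u v w ps → PathArc u ps v x y → x ≢ y × ¬ Arc M x y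
    route-avoids (direct uw)          single = u≢v , λ uv → w≢v (out-unique uw uv)
    route-avoids (direct′ _ _ ¬u)     single = u≢v , ¬u v
    route-avoids (via ¬uw ¬wv)        first  = w≢u ∘ sym , ¬uw
    route-avoids (via ¬uw ¬wv) (later single) = w≢v , ¬wv
    route-avoids (detour ¬uw wv ua)   first  = w≢u ∘ sym , ¬uw
    route-avoids (detour ¬uw wv ua)   (later first) =
      (λ { refl → ¬uw ua }) , λ wa → w≢u (in-unique wa ua)
    route-avoids (detour ¬uw wv ua)   (later (later single)) =
      (λ { refl → w≢u (in-unique wv ua) }) , λ av → ¬uw (subst (Arc M u) (in-unique av wv) ua)

    -- This coarse description serves to keep opposite directions apart. The third alternative
    -- covers the middle arc `w a` of a detour, whose head is the successor of `u` in `M`.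
    route-shape : ∀ {ps x y} → Route u v w ps → PathArc u ps v x y →
                  x ≢ v × y ≢ u × (x ≡ u ⊎ y ≡ v ⊎ Arc M u y)
    route-shape (direct _)         single = u≢v , u≢v ∘ sym , inj₁ refl
    route-shape (direct′ _ _ _)    single = u≢v , u≢v ∘ sym , inj₁ refl
    route-shape (via _ _)          first  = u≢v , w≢u , inj₁ refl
    route-shape (via _ _) (later single)  = w≢v , u≢v ∘ sym , inj₂ (inj₁ refl)
    route-shape (detour _ _ _)     first  = u≢v , w≢u , inj₁ refl
    route-shape (detour _ _ ua) (later first) =
      w≢v , (λ { refl → irreflexive ua }) , inj₂ (inj₂ ua)
    route-shape (detour _ wv ua) (later (later single)) =
      (λ { refl → w≢u (in-unique wv ua) }) , u≢v ∘ sym , inj₂ (inj₁ refl)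

    route-owns : ∀ {ps x y} → Route u v w ps → PathArc u ps v x y → Owns u v w x y
    route-owns (direct uw)         single = chord refl refl (inj₁ uw)
    route-owns (direct′ _ wv ¬u)   single = chord refl refl (inj₂ (wv , ¬u))
    route-owns (via _ _)           first  = start refl w≢v refl
    route-owns (via ¬uw _) (later single) = finish w≢u refl (inj₁ (refl , ¬uw))
    route-owns (detour _ _ _)      first  = start refl w≢v refl
    route-owns (detour _ wv ua) (later first) =
      inner w≢u (λ { refl → w≢u (in-unique wv ua) }) refl
    route-owns (detour _ wv ua) (later (later single)) =
      finish (λ { refl → irreflexive ua }) refl (inj₂ (wv , ua))

  -- Whether `x` is `u` and whether `y` is `v` separates the four constructors. Inside `chord` and
  -- `finish` the conditions on out-arcs of `u` exclude the mixed cases, and uniqueness of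
  -- neighbours in `M` settles the others.
  owner-unique : ∀ {u v w w′ x y} → Owns u v w x y → Owns u v w′ x y → w ≡ w′
  owner-unique (chord _ _ (inj₁ uw))        (chord _ _ (inj₁ uw′))       = out-unique uw uw′
  owner-unique (chord _ _ (inj₁ uw))        (chord _ _ (inj₂ (_ , ¬u)))  = ⊥-elim (¬u _ uw)
  owner-unique (chord _ _ (inj₂ (_ , ¬u)))  (chord _ _ (inj₁ uw′))       = ⊥-elim (¬u _ uw′)
  owner-unique (chord _ _ (inj₂ (wv , _)))  (chord _ _ (inj₂ (w′v , _))) = in-unique wv w′v
  owner-unique (chord _ y≡v _)              (start _ y≢v _)              = ⊥-elim (y≢v y≡v)
  owner-unique (chord x≡u _ _)              (finish x≢u _ _)             = ⊥-elim (x≢u x≡u)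
  owner-unique (chord x≡u _ _)              (inner x≢u _ _)              = ⊥-elim (x≢u x≡u)
  owner-unique (start _ y≢v _)              (chord _ y≡v _)              = ⊥-elim (y≢v y≡v)
  owner-unique (start _ _ refl)             (start _ _ refl)             = refl
  owner-unique (start x≡u _ _)              (finish x≢u _ _)             = ⊥-elim (x≢u x≡u)
  owner-unique (start x≡u _ _)              (inner x≢u _ _)              = ⊥-elim (x≢u x≡u)
  owner-unique (finish x≢u _ _)             (chord x≡u _ _)              = ⊥-elim (x≢u x≡u)
  owner-unique (finish x≢u _ _)             (start x≡u _ _)              = ⊥-elim (x≢u x≡u)
  owner-unique (finish _ _ (inj₁ (refl , _))) (finish _ _ (inj₁ (refl , _))) = refl
  owner-unique (finish _ _ (inj₁ (_ , ¬ux))) (finish _ _ (inj₂ (_ , ux))) = ⊥-elim (¬ux ux)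
  owner-unique (finish _ _ (inj₂ (_ , ux))) (finish _ _ (inj₁ (_ , ¬ux))) = ⊥-elim (¬ux ux)
  owner-unique (finish _ _ (inj₂ (wv , _))) (finish _ _ (inj₂ (w′v , _))) = in-unique wv w′v
  owner-unique (finish _ y≡v _)             (inner _ y≢v _)              = ⊥-elim (y≢v y≡v)
  owner-unique (inner x≢u _ _)              (chord x≡u _ _)              = ⊥-elim (x≢u x≡u)
  owner-unique (inner x≢u _ _)              (start x≡u _ _)              = ⊥-elim (x≢u x≡u)
  owner-unique (inner _ y≢v _)              (finish _ y≡v _)             = ⊥-elim (y≢v y≡v)
  owner-unique (inner _ _ refl)             (inner _ _ refl)             = refl

  -- An arc that leaves `u` or enters `v` cannot lie on the reverse route, and conversely. A common
  -- arc is therefore the middle arc of two detours, and its head would have both `u` and `v` as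
  -- predecessors in `M`.
  opposite-disjoint : ∀ {u v w w′} → u ≢ v → w ≢ u → w ≢ v → w′ ≢ u → w′ ≢ v →
                      ∀ {ps qs x y} → Route u v w ps → Route v u w′ qs →
                      PathArc u ps v x y → ¬ PathArc v qs u x y
  opposite-disjoint u≢v w≢u w≢v w′≢u w′≢v r r′ p q
    with route-shape u≢v w≢u w≢v r p | route-shape (u≢v ∘ sym) w′≢v w′≢u r′ q
  ... | _ , _ , inj₁ x≡u         | x≢u , _ , _                = x≢u x≡u
  ... | _ , _ , inj₂ (inj₁ y≡v)  | _ , y≢v , _                = y≢v y≡v
  ... | x≢v , _ , _              | _ , _ , inj₁ x≡v           = x≢v x≡v
  ... | _ , y≢u , _              | _ , _ , inj₂ (inj₁ y≡u)    = y≢u y≡u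
  ... | _ , _ , inj₂ (inj₂ uy)   | _ , _ , inj₂ (inj₂ vy)     = u≢v (in-unique uy vy)

  -- Stated for any `D` containing all arcs outside `M`, so that it also applies, with an enlarged
  -- `M`, after an arc has been deleted.
  packing : (D : Digraph n) → (∀ {x y} → x ≢ y → ¬ Arc M x y → Arc (arcs D) x y) →
            (S : Subset n) → ∣ S ∣ ≡ 2 → StrongPacking D S (n ∸ 2)
  packing D M̅⊆D S ∣S∣≡2 = record
    { member   = λ i → loop D u v (ps i) (qs i) (p⊆ i) (q⊆ i)
    ; strong   = λ i → loop-strong D u v (ps i) (qs i) (p⊆ i) (q⊆ i)
    ; contains = λ i z∈S → [ (λ { refl → loop-∋u D u v (ps i) (qs i) (p⊆ i) (q⊆ i) })
                           , (λ { refl → loop-∋v D u v (ps i) (qs i) (p⊆ i) (q⊆ i) }) ]′ (either z∈S)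
    ; disjoint = λ i j i≢j x y (a , b) → apart i j i≢j
                   (to (T-does (loopArc? D u v (ps i) (qs i) x y)) a)
                   (to (T-does (loopArc? D u v (ps j) (qs j) x y)) b)
    }
    where
    open Pair (∣S∣≡2⇒Pair S ∣S∣≡2)

    v≢u : v ≢ u
    v≢u = u≢v ∘ sym

    w : Fin (n ∸ 2) → Fin n
    w = proj₁ (others u v u≢v)

    w≢u : ∀ i → w i ≢ u
    w≢u i = proj₁ (proj₂ (proj₂ (others u v u≢v)) i)

    w≢v : ∀ i → w i ≢ v
    w≢v i = proj₂ (proj₂ (proj₂ (others u v u≢v)) i)

    ps qs : Fin (n ∸ 2) → List (Fin n)
    ps i = proj₁ (route u v (w i))
    qs i = proj₁ (route v u (w i))

    p-route : ∀ i → Route u v (w i) (ps i)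
    p-route i = proj₂ (route u v (w i))

    q-route : ∀ i → Route v u (w i) (qs i)
    q-route i = proj₂ (route v u (w i))

    p⊆ : ∀ i {x y} → PathArc u (ps i) v x y → Arc (arcs D) x y
    p⊆ i p with x≢y , ¬xy ← route-avoids u≢v (w≢u i) (w≢v i) (p-route i) p = M̅⊆D x≢y ¬xy

    q⊆ : ∀ i {x y} → PathArc v (qs i) u x y → Arc (arcs D) x y
    q⊆ i q with x≢y , ¬xy ← route-avoids v≢u (w≢v i) (w≢u i) (q-route i) q = M̅⊆D x≢y ¬xy

    apart : ∀ i j → i ≢ j → ∀ {x y} →
            PathArc u (ps i) v x y ⊎ PathArc v (qs i) u x y →
            ¬ (PathArc u (ps j) v x y ⊎ PathArc v (qs j) u x y)
    apart i j i≢j (inj₁ p) (inj₁ p′) = i≢j (proj₁ (proj₂ (others u v u≢v)) (owner-unique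
      (route-owns u≢v (w≢u i) (w≢v i) (p-route i) p) (route-owns u≢v (w≢u j) (w≢v j) (p-route j) p′)))
    apart i j i≢j (inj₂ q) (inj₂ q′) = i≢j (proj₁ (proj₂ (others u v u≢v)) (owner-unique
      (route-owns v≢u (w≢v i) (w≢u i) (q-route i) q) (route-owns v≢u (w≢v j) (w≢u j) (q-route j) q′)))
    apart i j _ (inj₁ p) (inj₂ q) =
      opposite-disjoint u≢v (w≢u i) (w≢v i) (w≢u j) (w≢v j) (p-route i) (q-route j) p q
    apart i j _ (inj₂ q) (inj₁ p) =
      opposite-disjoint u≢v (w≢u j) (w≢v j) (w≢u i) (w≢v i) (p-route j) (q-route i) p q

-- Degree bounds

∷-injective : (x : Fin n) (g : Fin m → Fin n) → Injective _≡_ _≡_ g → (∀ i → g i ≢ x) →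
              Injective _≡_ _≡_ (x ∷ᶠ g)
∷-injective x g inj ≢x {zero}  {zero}  _  = refl
∷-injective x g inj ≢x {zero}  {suc j} eq = ⊥-elim (≢x j (sym eq))
∷-injective x g inj ≢x {suc i} {zero}  eq = ⊥-elim (≢x i eq)
∷-injective x g inj ≢x {suc i} {suc j} eq = cong suc (inj eq)

-- Prepending the missed value keeps the map injective, so the pigeonhole bound improves by one.
avoid-1 : ∀ {a} (g : Fin m → Fin n) → Injective _≡_ _≡_ g → (∀ i → g i ≢ a) → 1 + m ≤ n
avoid-1 {a = a} g inj ≢a = injective⇒≤ (∷-injective a g inj ≢a)

avoid-2 : ∀ {a b} → a ≢ b → (g : Fin m → Fin n) → Injective _≡_ _≡_ g →
          (∀ i → g i ≢ a) → (∀ i → g i ≢ b) → 2 + m ≤ n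
avoid-2 {a = a} a≢b g inj ≢a ≢b = avoid-1 (a ∷ᶠ g) (∷-injective a g inj ≢a) λ where
  zero    → a≢b
  (suc i) → ≢b i

avoid-3 : ∀ {a b c} → a ≢ b → a ≢ c → b ≢ c → (g : Fin m → Fin n) → Injective _≡_ _≡_ g →
          (∀ i → g i ≢ a) → (∀ i → g i ≢ b) → (∀ i → g i ≢ c) → 3 + m ≤ n
avoid-3 {a = a} a≢b a≢c b≢c g inj ≢a ≢b ≢c =
  avoid-2 b≢c (a ∷ᶠ g) (∷-injective a g inj ≢a)
    (λ { zero → a≢b ; (suc i) → ≢b i }) (λ { zero → a≢c ; (suc i) → ≢c i })

first-step : ∀ {A : Set} {R : A → A → Set} {x y} → x ≢ y → Star R x y → ∃[ z ] R x z
first-step x≢y ε       = ⊥-elim (x≢y refl)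
first-step x≢y (r ◅ _) = _ , r

last-step : ∀ {A : Set} {R : A → A → Set} {x y} → x ≢ y → Star R x y → ∃[ z ] R z y
last-step x≢y ε        = ⊥-elim (x≢y refl)
last-step x≢y (r ◅ rs) = go r rs
  where
  go : ∀ {A : Set} {R : A → A → Set} {x y z} → R x y → Star R y z → ∃[ w ] R w z
  go r ε        = _ , r
  go _ (r ◅ rs) = go r rs

module _ {D : Digraph n} {S : Subset n} {x y : Fin n} (x≢y : x ≢ y) (x∈S : x ∈ S) (y∈S : y ∈ S)
         (P : StrongPacking D S m) where
  open StrongPacking P

  private
    leave : ∀ i → ∃[ z ] Arc (arcSet (member i)) x z
    leave i = first-step x≢y (strong i x y (contains i x∈S) (contains i y∈S))

    enter : ∀ i → ∃[ z ] Arc (arcSet (member i)) z x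
    enter i = last-step (x≢y ∘ sym) (strong i y x (contains i y∈S) (contains i x∈S))

    leave-arc : ∀ i → Arc (arcs D) x (proj₁ (leave i))
    leave-arc i = arcs⊆ (member i) _ _ (proj₂ (leave i))

    enter-arc : ∀ i → Arc (arcs D) (proj₁ (enter i)) x
    enter-arc i = arcs⊆ (member i) _ _ (proj₂ (enter i))

    -- Members choosing the same out-neighbour would share an arc. Hence `x` has `m` different
    -- out-neighbours in `D`.
    leave-injective : Injective _≡_ _≡_ (proj₁ ∘ leave)
    leave-injective {i} {j} eq with i ≟ j
    ... | yes i≡j = i≡j
    ... | no  i≢j = ⊥-elim (disjoint i j i≢j _ _
      (proj₂ (leave i) , subst (Arc (arcSet (member j)) x) (sym eq) (proj₂ (leave j))))

    enter-injective : Injective _≡_ _≡_ (proj₁ ∘ enter)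
    enter-injective {i} {j} eq with i ≟ j
    ... | yes i≡j = i≡j
    ... | no  i≢j = ⊥-elim (disjoint i j i≢j _ _
      (proj₂ (enter i) , subst (λ z → Arc (arcSet (member j)) z x) (sym eq) (proj₂ (enter j))))

    leave-≢ : ∀ {z} → ¬ Arc (arcs D) x z → ∀ i → proj₁ (leave i) ≢ z
    leave-≢ ¬xz i refl = ¬xz (leave-arc i)

    enter-≢ : ∀ {z} → ¬ Arc (arcs D) z x → ∀ i → proj₁ (enter i) ≢ z
    enter-≢ ¬zx i refl = ¬zx (enter-arc i)

  -- The chosen out-neighbours miss `x` itself, since there are no loops, and also `a`. Below, each
  -- further missing arc costs one more.
  out-bound-2 : ∀ {a} → x ≢ a → ¬ Arc (arcs D) x a → 2 + m ≤ n
  out-bound-2 x≢a ¬xa =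
    avoid-2 x≢a _ leave-injective (leave-≢ (loopless D x)) (leave-≢ ¬xa)

  out-bound-3 : ∀ {a b} → x ≢ a → x ≢ b → a ≢ b →
                ¬ Arc (arcs D) x a → ¬ Arc (arcs D) x b → 3 + m ≤ n
  out-bound-3 x≢a x≢b a≢b ¬xa ¬xb =
    avoid-3 x≢a x≢b a≢b _ leave-injective (leave-≢ (loopless D x)) (leave-≢ ¬xa) (leave-≢ ¬xb)

  in-bound-3 : ∀ {a b} → x ≢ a → x ≢ b → a ≢ b →
               ¬ Arc (arcs D) a x → ¬ Arc (arcs D) b x → 3 + m ≤ n
  in-bound-3 x≢a x≢b a≢b ¬ax ¬bx =
    avoid-3 x≢a x≢b a≢b _ enter-injective (enter-≢ (loopless D x)) (enter-≢ ¬ax) (enter-≢ ¬bx)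

-- Monotonicity of packings and the values of λ

packing-empty : ∀ {D : Digraph n} {S} → StrongPacking D S 0
packing-empty = record { member = λ () ; strong = λ () ; contains = λ () ; disjoint = λ () }

packing-pred : ∀ {D : Digraph n} {S} → StrongPacking D S (suc m) → StrongPacking D S m
packing-pred P = record
  { member   = member ∘ suc
  ; strong   = strong ∘ suc
  ; contains = λ i → contains (suc i)
  ; disjoint = λ i j i≢j → disjoint (suc i) (suc j) (i≢j ∘ suc-injective)
  }
  where open StrongPacking P

packing-≤ : ∀ {D : Digraph n} {S} → k ≤ m → StrongPacking D S m → StrongPacking D S k
packing-≤ {m = zero}  z≤n P = P
packing-≤ {m = suc m} k≤1+m P with m≤n⇒m<n∨m≡n k≤1+m
... | inj₁ k<1+m = packing-≤ (≤-pred k<1+m) (packing-pred P)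
... | inj₂ refl  = P

-- At most one member uses the deleted arc, and it is dropped.
packing-delete : ∀ {D : Digraph n} {S} x y →
                 StrongPacking D S (suc m) → StrongPacking (D ─ singleArc x y) S m
packing-delete {m = m} {D = D} x y P = record
  { member   = λ i → record
      { verts  = verts (member (punchIn d i))
      ; arcSet = arcSet (member (punchIn d i))
      ; arcs⊆  = λ s t a → from T-∧ (arcs⊆ (member (punchIn d i)) s t a , kept i s t a)
      ; ends   = ends (member (punchIn d i))
      }
  ; strong   = λ i → strong (punchIn d i)
  ; contains = λ i → contains (punchIn d i)
  ; disjoint = λ i j i≢j → disjoint _ _ (i≢j ∘ punchIn-injective d i j)
  }
  where
  open StrongPacking P

  culprit : ∃[ d ] (∀ i → i ≢ d → ¬ Arc (arcSet (member i)) x y)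
  culprit with any? (λ i → T? (arcSet (member i) x y))
  ... | yes (d , a) = d , λ i i≢d b → disjoint i d i≢d x y (b , a)
  -- If no member uses the arc, an arbitrary one is dropped.
  ... | no  ¬∃      = zero , λ i _ b → ¬∃ (i , b)

  d = proj₁ culprit

  kept : ∀ i s t → Arc (arcSet (member (punchIn d i))) s t → T (not (singleArc x y s t))
  kept i s t a with s ≟ x | t ≟ y
  ... | no _     | _        = _
  ... | yes _    | no _     = _
  ... | yes refl | yes refl = proj₂ culprit (punchIn d i) (punchInᵢ≢i d i) a

-- One set attaining the bound `m` has maximum exactly `m`, and the packings of size `m` keep every
-- other maximum from being smaller.
isLambda : ∀ {D : Digraph n} → (∀ S → ∣ S ∣ ≡ k → StrongPacking D S m) →
           (S : Subset n) → ∣ S ∣ ≡ k → (∀ {m′} → StrongPacking D S m′ → m′ ≤ m) →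
           IsLambda k D m
isLambda packings S ∣S∣≡k bound =
  (S , ∣S∣≡k , packings S ∣S∣≡k , λ _ → bound) ,
  λ { _ (S′ , ∣S′∣≡k , _ , maximal) → maximal _ (packings S′ ∣S′∣≡k) }

-- Constructively the maximum λ_S need not be at hand, hence the double negation.
lambda⇒packing : ∀ {D : Digraph n} {S ℓ} → IsLambda k D ℓ → ∣ S ∣ ≡ k →
                 ∀ {m} → m ≤ ℓ → ¬ ¬ StrongPacking D S m
lambda⇒packing _ _ {zero} _ ¬P = ¬P packing-empty
-- If size `m` is possible but `suc m` is not, then `m` is the maximum for `S`, which lies below the
-- minimum `ℓ`.
lambda⇒packing λD@(_ , minimal) ∣S∣≡k {suc m} m<ℓ ¬P =
  lambda⇒packing λD ∣S∣≡k (<⇒≤ m<ℓ) λ P →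
    <-irrefl refl (≤-trans m<ℓ (minimal m (_ , ∣S∣≡k , P , maximal)))
  where
  maximal : ∀ m′ → StrongPacking _ _ m′ → m′ ≤ m
  maximal m′ P′ with m′ ≤? m
  ... | yes m′≤m = m′≤m
  ... | no  m′≰m = ⊥-elim (¬P (packing-≤ (≰⇒> m′≰m) P′))

-- Cycles of an injective map

least : ∀ {P : Pred ℕ 0ℓ} → Decidable P → ∀ k → P k → ∃[ m ] (P m × (∀ {j} → j < m → ¬ P j))
least P? k Pk with P? 0
least P? k       Pk | yes P0 = 0 , P0 , λ ()
least P? zero    P0 | no ¬P0 = ⊥-elim (¬P0 P0)
least P? (suc k) Pk | no ¬P0 with m , Pm , below ← least (P? ∘ suc) k Pk =
  suc m , Pm , λ { {zero} _ → ¬P0 ; {suc j} (s≤s j<m) → below j<m }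

arc-tail : ∀ {C : Cycle n} {x y} → CycleArc C x y → OnCycle C x
arc-tail (step i) = inject₁ i , refl
arc-tail close    = _ , refl

arc-head : ∀ {C : Cycle n} {x y} → CycleArc C x y → OnCycle C y
arc-head (step i) = suc i , refl
arc-head close    = _ , refl

module FunctionCycles {n} (f : Fin n → Fin n) (f-injective : Injective _≡_ _≡_ f) where

  fold-cancel : ∀ i {x y} → fold x f i ≡ fold y f i → x ≡ y
  fold-cancel zero    eq = eq
  fold-cancel (suc i) eq = fold-cancel i (f-injective eq)

  -- Injectivity cancels the first `i` steps. The difference of `j` and `i` is written as a
  -- successor to show that it is positive.
  fold-shift : ∀ {v i j} → i < j → fold v f i ≡ fold v f j → fold v f (suc (j ∸ suc i)) ≡ v
  fold-shift {v} {i} {j} i<j eq = sym (fold-cancel i (trans eq (trans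
    (cong (fold v f) (sym (trans (+-suc i _) (m+[n∸m]≡n i<j)))) (fold-+ v f i))))

  returns : ∀ v → ∃[ k ] fold v f (suc k) ≡ v
  returns v with i , j , i<j , eq ← pigeonhole (n<1+n n) (λ (i : Fin (suc n)) → fold v f (toℕ i)) =
    toℕ j ∸ suc (toℕ i) , fold-shift i<j eq

  record FunctionCycle : Set where
    field
      cycle   : Cycle n
      arc⇒f   : ∀ {x y} → CycleArc cycle x y → y ≡ f x
      f⇒arc   : ∀ {x} → OnCycle cycle x → CycleArc cycle x (f x)
      moved   : ∀ {x} → OnCycle cycle x → f x ≢ x

  open FunctionCycle public

  on-fold : ∀ (C : FunctionCycle) {x} k → OnCycle (cycle C) x → OnCycle (cycle C) (fold x f k)
  on-fold C zero    on = on
  on-fold C (suc k) on = arc-head (f⇒arc C (on-fold C k on))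

  -- The vertices are the iterates of `v` up to its least return time `2 + e`, which exceeds 1
  -- because `v` is moved. An earlier repetition would give an earlier return. The last component
  -- serves to prove that a new orbit is disjoint from earlier ones.
  orbit : ∀ v → f v ≢ v →
          Σ[ C ∈ FunctionCycle ] (OnCycle (cycle C) v ×
                                  (∀ {x} → OnCycle (cycle C) x → ∃[ k ] fold x f k ≡ v))
  orbit v fv≢v with least (λ k → fold v f (suc k) ≟ v) (proj₁ (returns v)) (proj₂ (returns v))
  ... | zero  , fv≡v , _     = ⊥-elim (fv≢v fv≡v)
  ... | suc e , back , below = record
          { cycle = C
          ; arc⇒f = λ where
              (step i) → cong (f ∘ fold v f) (sym (toℕ-inject₁ i))
              close    → sym last
          ; f⇒arc = λ { (i , refl) → next i }
          -- If the `i`-th iterate were fixed, cancelling `i` steps would make `v` fixed.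
          ; moved = λ { (i , refl) eq → fv≢v (fold-cancel (toℕ i)
              (trans (trans (sym (fold-+ v f (toℕ i) {1})) (cong (fold v f) (+-comm (toℕ i) 1))) eq)) }
          }
      , (zero , refl)
      , λ { (i , refl) → (2 + e) ∸ toℕ i , trans (sym (fold-+ v f ((2 + e) ∸ toℕ i)))
                         (trans (cong (fold v f) (m∸n+n≡m (<⇒≤ (toℕ<n i)))) back) }
    where
    no-return : ∀ (i j : Fin (2 + e)) → toℕ i < toℕ j → fold v f (toℕ i) ≢ fold v f (toℕ j)
    no-return i j i<j eq = below (≤-trans (∸-<-suc (toℕ i) i<j) (≤-pred (toℕ<n j))) (fold-shift i<j eq)
      where
      ∸-<-suc : ∀ i {j} → i < j → j ∸ suc i < j
      ∸-<-suc i {suc j} _ = s≤s (m∸n≤m j i)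

    C : Cycle n
    C = record
      { extra     = e
      ; vertex    = λ i → fold v f (toℕ i)
      ; injective = λ {i} {j} eq → inj i j eq
      }
      where
      inj : ∀ i j → fold v f (toℕ i) ≡ fold v f (toℕ j) → i ≡ j
      inj i j eq with <-cmp (toℕ i) (toℕ j)
      ... | tri< i<j _ _ = ⊥-elim (no-return i j i<j eq)
      ... | tri≈ _ i≡j _ = toℕ-injective i≡j
      ... | tri> _ _ j<i = ⊥-elim (no-return j i j<i (sym eq))

    last : f (vertex C (fromℕ (suc e))) ≡ v
    last = trans (cong (f ∘ fold v f) (toℕ-fromℕ (suc e))) back

    next : ∀ i → CycleArc C (vertex C i) (f (vertex C i))
    next i with view i
    ... | ‵fromℕ     = subst (CycleArc C _) (sym last) close
    ... | ‵inject₁ j = subst (CycleArc C _) (cong (f ∘ fold v f) (sym (toℕ-inject₁ j))) (step j)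

  on? : ∀ (C : Cycle n) x → Dec (OnCycle C x)
  on? C x = any? λ i → vertex C i ≟ x

  -- Relative to a list, so that cycles can be collected vertex by vertex; the list of all vertices
  -- gives the cycle decomposition of `f`.
  record Decomposition (vs : List (Fin n)) : Set where
    field
      size     : ℕ
      cycles   : Fin size → FunctionCycle
      disjoint : ∀ i j → i ≢ j → VertexDisjoint (cycle (cycles i)) (cycle (cycles j))
      covers   : ∀ {v} → v ∈ˡ vs → f v ≢ v → ∃[ i ] OnCycle (cycle (cycles i)) v

  decompose : ∀ vs → Decomposition vs
  decompose [] = record { size = 0 ; cycles = λ () ; disjoint = λ () ; covers = λ () }
  decompose (v ∷ vs) with d ← decompose vs
    with f v ≟ v | any? (λ i → on? (cycle (Decomposition.cycles d i)) v)
  ... | yes fv≡v | _      = record { Decomposition d ; covers = λ where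
          (here refl) fv≢v → ⊥-elim (fv≢v fv≡v)
          (there v∈)       → Decomposition.covers d v∈ }
  ... | no _    | yes on = record { Decomposition d ; covers = λ where
          (here refl) _ → on
          (there v∈)    → Decomposition.covers d v∈ }
  ... | no fv≢v | no off with C , v∈C , back ← orbit v fv≢v = record
    { size = suc size ; cycles = C ∷ᶠ cycles ; disjoint = disjoint′
    ; covers = λ where
        (here refl) _      → zero , v∈C
        (there v∈)  fv≢v → let i , on = covers v∈ fv≢v in suc i , on }
    where
    open Decomposition d
    -- Iterating `f` from a common vertex leads back to `v` without leaving the older cycle, but `v`
    -- is on no older cycle.
    fresh : ∀ i x → OnCycle (cycle C) x → ¬ OnCycle (cycle (cycles i)) x
    fresh i x onC on with k , eq ← back onC =
      off (i , subst (OnCycle (cycle (cycles i))) eq (on-fold (cycles i) k on))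

    disjoint′ : ∀ i j → i ≢ j →
                VertexDisjoint (cycle ((C ∷ᶠ cycles) i)) (cycle ((C ∷ᶠ cycles) j))
    disjoint′ zero    zero    i≢j = ⊥-elim (i≢j refl)
    disjoint′ zero    (suc j) _   = λ x (a , b) → fresh j x a b
    disjoint′ (suc i) zero    _   = λ x (a , b) → fresh i x b a
    disjoint′ (suc i) (suc j) i≢j = disjoint i j (i≢j ∘ cong suc)

-- Cycle unions from permutations with at most one fixed point

module _ {M : ArcSet n} (M⊆K : M ⊆ᴬ arcs (complete n)) (f : Fin n → Fin n)
         (f-injective : Injective _≡_ _≡_ f)
         (M⇒f : ∀ {x y} → Arc M x y → y ≡ f x) (f⇒M : ∀ {x} → f x ≢ x → Arc M x (f x))
         (fixed-unique : ∀ {x y} → f x ≡ x → f y ≡ y → x ≡ y) where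
  open FunctionCycles f f-injective
  open Decomposition (decompose (allFin n))

  private
    M-irreflexive : ∀ {x y} → Arc M x y → x ≢ y
    M-irreflexive {x} a refl = loopless (complete n) x (M⊆K x x a)

    M⇒cycle : ∀ {x y} → Arc M x y → ∃[ i ] CycleArc (cycle (cycles i)) x y
    M⇒cycle {x} a with refl ← M⇒f a =
      let i , on = covers (∈-allFin x) (M-irreflexive a ∘ sym) in i , f⇒arc (cycles i) on

    cycle⇒M : ∀ {x y} i → CycleArc (cycle (cycles i)) x y → Arc M x y
    cycle⇒M i a with refl ← arc⇒f (cycles i) a = f⇒M (moved (cycles i) (arc-tail a))

    uncovered⇒fixed : ∀ {x} → ¬ (∃[ i ] OnCycle (cycle (cycles i)) x) → f x ≡ x
    uncovered⇒fixed {x} off = decidable-stable (f x ≟ x) (off ∘ covers (∈-allFin x))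

    H : Subdigraph (complete n)
    H = arcInduced (complete n) M M⊆K

    incident⇒on : ∀ {x} → Incident M x → ∃[ i ] OnCycle (cycle (cycles i)) x
    incident⇒on (_ , inj₁ a) = let i , c = M⇒cycle a in i , arc-tail c
    incident⇒on (_ , inj₂ a) = let i , c = M⇒cycle a in i , arc-head c

  function⇒cycleUnion : IsAlmostSpanningDisjointCycleUnion (arcInduced (complete n) M M⊆K)
  function⇒cycleUnion = size , cycle ∘ cycles , disjoint ,
    ((λ x → mk⇔ (incident⇒on ∘ ∈endVertices⇒Incident M)
                (λ (i , on) → proj₁ (ends H _ _ (cycle⇒M i (f⇒arc (cycles i) on))))) ,
     (λ x y → mk⇔ M⇒cycle (λ (i , c) → cycle⇒M i c))) ,
    λ x y x-off y-off → fixed-unique (uncovered⇒fixed x-off) (uncovered⇒fixed y-off)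

-- Arcs of complete digraphs and of digraphs with deleted arcs

T-not : ∀ {b} → T (not b) ⇔ (¬ T b)
T-not {false} = mk⇔ (λ _ ()) (λ _ → _)
T-not {true}  = mk⇔ (λ ()) (λ ¬t → ¬t _)

pair∋ˡ : (x y : Fin n) → x ∈ ⁅ x ⁆ ∪ ⁅ y ⁆
pair∋ˡ x y = x∈p∪q⁺ (inj₁ (x∈⁅x⁆ x))

pair∋ʳ : (x y : Fin n) → y ∈ ⁅ x ⁆ ∪ ⁅ y ⁆
pair∋ʳ x y = x∈p∪q⁺ (inj₂ (x∈⁅x⁆ y))

distinct-pair : 2 ≤ n → Σ[ x ∈ Fin n ] ∃[ y ] x ≢ y
distinct-pair (s≤s (s≤s _)) = zero , suc zero , λ ()

complete-arc : {x y : Fin n} → Arc (arcs (complete n)) x y ⇔ x ≢ y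
complete-arc {x = x} {y} = mk⇔
  (λ t x≡y → to T-not t (from (T-does (x ≟ y)) x≡y))
  (λ x≢y → from T-not (x≢y ∘ to (T-does (x ≟ y))))

delete-arc : (D : Digraph n) (M : ArcSet n) {x y : Fin n} →
             Arc (arcs (D ─ M)) x y ⇔ (Arc (arcs D) x y × ¬ Arc M x y)
delete-arc D M = mk⇔ (λ t → let a , b = to T-∧ t in a , to T-not b)
                     (λ (a , b) → from T-∧ (a , from T-not b))

singleArc-arc : {x y s t : Fin n} → Arc (singleArc x y) s t ⇔ (s ≡ x × t ≡ y)
singleArc-arc {x = x} {y} {s} {t} = mk⇔
  (λ a → let p , q = to T-∧ a in to (T-does (s ≟ x)) p , to (T-does (t ≟ y)) q)
  (λ (p , q) → from T-∧ (from (T-does (s ≟ x)) p , from (T-does (t ≟ y)) q))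

-- Disjoint unions of cycles

-- The tails are two variables joined by an equation because the indices of `CycleArc` are values of
-- `vertex C`, which matching cannot unify; injectivity of `vertex C` takes over.
cycleArc-out-unique : ∀ (C : Cycle n) {x x′ y z} → CycleArc C x y → CycleArc C x′ z → x ≡ x′ → y ≡ z
cycleArc-out-unique C (step i) (step j) eq = cong (vertex C ∘ suc) (inject₁-injective (injective C eq))
cycleArc-out-unique C (step i) close    eq = ⊥-elim (fromℕ≢inject₁ (sym (injective C eq)))
cycleArc-out-unique C close    (step j) eq = ⊥-elim (fromℕ≢inject₁ (injective C eq))
cycleArc-out-unique C close    close    eq = refl

cycleArc-in-unique : ∀ (C : Cycle n) {x y z z′} → CycleArc C x z → CycleArc C y z′ → z ≡ z′ → x ≡ y
cycleArc-in-unique C (step i) (step j) eq = cong (vertex C ∘ inject₁) (suc-injective (injective C eq))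
cycleArc-in-unique C (step i) close    eq with () ← injective C eq
cycleArc-in-unique C close    (step j) eq with () ← injective C eq
cycleArc-in-unique C close    close    eq = refl

cycle-successor : ∀ (C : Cycle n) {x} → OnCycle C x → ∃[ y ] CycleArc C x y
cycle-successor C (i , refl) with view i
... | ‵fromℕ     = _ , close
... | ‵inject₁ j = _ , step j

cycle-predecessor : ∀ (C : Cycle n) {x} → OnCycle C x → ∃[ y ] CycleArc C y x
cycle-predecessor C (zero  , refl) = _ , close
cycle-predecessor C (suc i , refl) = _ , step i

module _ {M : ArcSet n} (M⊆K : M ⊆ᴬ arcs (complete n))
         (union : IsAlmostSpanningDisjointCycleUnion (arcInduced (complete n) M M⊆K)) where
  private
    C : Fin (proj₁ union) → Cycle n
    C = proj₁ (proj₂ union)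

    C-disjoint : ∀ i j → i ≢ j → VertexDisjoint (C i) (C j)
    C-disjoint = proj₁ (proj₂ (proj₂ union))

    M⇔C : ∀ x y → Arc M x y ⇔ (∃[ i ] CycleArc (C i) x y)
    M⇔C = proj₂ (proj₁ (proj₂ (proj₂ (proj₂ union))))

    almost : CoverAllButAtMostOne C
    almost = proj₂ (proj₂ (proj₂ (proj₂ union)))

    same-cycle : ∀ {x} i j → OnCycle (C i) x → OnCycle (C j) x → i ≡ j
    same-cycle i j on on′ with i ≟ j
    ... | yes i≡j = i≡j
    ... | no  i≢j = ⊥-elim (C-disjoint i j i≢j _ (on , on′))

    covered? : ∀ x → Dec (∃[ i ] OnCycle (C i) x)
    covered? x = any? λ i → any? λ j → vertex (C i) j ≟ x

    neighbours : ∀ {x} → ∃[ i ] OnCycle (C i) x → (∃[ z ] Arc M x z) × (∃[ z ] Arc M z x)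
    neighbours {x} (i , on) =
      let z , a = cycle-successor (C i) on ; w , b = cycle-predecessor (C i) on
      in (z , from (M⇔C x z) (i , a)) , (w , from (M⇔C w x) (i , b))

  cycleUnion⇒partialPermutation : PartialPermutation M
  cycleUnion⇒partialPermutation = record
    { irreflexive = λ {x} xx → loopless (complete n) x (M⊆K x x xx)
    ; out-unique  = out
    ; in-unique   = inn
    }
    where
    out : ∀ {x y z} → Arc M x y → Arc M x z → y ≡ z
    out {x} {y} {z} xy xz with i , c ← to (M⇔C x y) xy | j , d ← to (M⇔C x z) xz
      with refl ← same-cycle i j (arc-tail c) (arc-tail d) = cycleArc-out-unique (C i) c d refl

    inn : ∀ {x y z} → Arc M x z → Arc M y z → x ≡ y
    inn {x} {y} {z} xz yz with i , c ← to (M⇔C x z) xz | j , d ← to (M⇔C y z) yz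
      with refl ← same-cycle i j (arc-head c) (arc-head d) = cycleArc-in-unique (C i) c d refl

  -- At most one vertex is uncovered, so `x` or `y` lies on a cycle.
  cycleUnion-covers : ∀ {x y} → x ≢ y →
    (∃[ z ] Arc M x z) × (∃[ z ] Arc M z x) ⊎ (∃[ z ] Arc M y z) × (∃[ z ] Arc M z y)
  cycleUnion-covers {x} {y} x≢y with covered? x | covered? y
  ... | yes on | _       = inj₁ (neighbours on)
  ... | no _   | yes on  = inj₂ (neighbours on)
  ... | no off | no off′ = ⊥-elim (x≢y (almost x y off off′))

-- Minimality from a cycle union

module _ {D : Digraph n} (2≤n : 2 ≤ n) {M : ArcSet n} (M⊆K : M ⊆ᴬ arcs (complete n))
         (D≐K─M : D ≐ (complete n ─ M))
         (union : IsAlmostSpanningDisjointCycleUnion (arcInduced (complete n) M M⊆K)) where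
  private
    D⇒ : ∀ {x y} → Arc (arcs D) x y → ¬ Arc M x y
    D⇒ {x} {y} a = proj₂ (to (delete-arc (complete n) M) (subst T (D≐K─M x y) a))

    ⇒D : ∀ {x y} → x ≢ y → ¬ Arc M x y → Arc (arcs D) x y
    ⇒D {x} {y} x≢y ¬xy =
      subst T (sym (D≐K─M x y)) (from (delete-arc (complete n) M) (from complete-arc x≢y , ¬xy))

    M⇒≢ : ∀ {x y} → Arc M x y → x ≢ y
    M⇒≢ xy = to complete-arc (M⊆K _ _ xy)

    packings : ∀ S → ∣ S ∣ ≡ 2 → StrongPacking D S (n ∸ 2)
    packings = Routes.packing M (cycleUnion⇒partialPermutation M⊆K union) D ⇒D

    -- One of the two vertices lies on a cycle and so loses an out-arc to `M`; its out-degree in `D`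
    -- is at most `n ∸ 2`.
    bound : ∀ {x y} → x ≢ y → ∀ {S} → x ∈ S → y ∈ S → ∀ {m} → StrongPacking D S m → 2 + m ≤ n
    bound x≢y x∈S y∈S P with cycleUnion-covers M⊆K union x≢y
    ... | inj₁ ((z , xz) , _) = out-bound-2 x≢y x∈S y∈S P (M⇒≢ xz) λ a → D⇒ a xz
    ... | inj₂ ((z , yz) , _) = out-bound-2 (x≢y ∘ sym) y∈S x∈S P (M⇒≢ yz) λ a → D⇒ a yz

    -- An end of the deleted arc that lies on a cycle now has degree n ∸ 3.
    bound-delete : ∀ {x y} → Arc (arcs D) x y → x ≢ y → ∀ {S} → x ∈ S → y ∈ S →
                   ∀ {m} → StrongPacking (D ─ singleArc x y) S m → 3 + m ≤ n
    bound-delete {x} {y} xy x≢y x∈S y∈S P with cycleUnion-covers M⊆K union x≢y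
    ... | inj₁ ((z , xz) , _) = out-bound-3 x≢y x∈S y∈S P x≢y (M⇒≢ xz) (λ { refl → D⇒ xy xz })
            (λ a → proj₂ (to (delete-arc D (singleArc x y)) a) (from (singleArc-arc {x = x} {y}) (refl , refl)))
            (λ a → D⇒ (proj₁ (to (delete-arc D (singleArc x y)) a)) xz)
    ... | inj₂ (_ , (z , zy)) = in-bound-3 (x≢y ∘ sym) y∈S x∈S P (x≢y ∘ sym) (M⇒≢ zy ∘ sym)
            (λ { refl → D⇒ xy zy })
            (λ a → proj₂ (to (delete-arc D (singleArc x y)) a) (from (singleArc-arc {x = x} {y}) (refl , refl)))
            (λ a → D⇒ (proj₁ (to (delete-arc D (singleArc x y)) a)) zy)

  cycleUnion⇒minimal : MinimallyStrongArcConnected 2 (n ∸ 2) D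
  cycleUnion⇒minimal = (n ∸ 2 , lambda , ≤-refl) , λ x y xy → n ∸ 3 , lambda-delete xy , smaller xy
    where
    lambda : IsLambda 2 D (n ∸ 2)
    lambda with x , y , x≢y ← distinct-pair 2≤n =
      isLambda packings (⁅ x ⁆ ∪ ⁅ y ⁆) (∣⁅x⁆∪⁅y⁆∣≡2 x y x≢y)
        λ P → ∸-monoˡ-≤ 2 (bound x≢y (pair∋ˡ x y) (pair∋ʳ x y) P)

    module _ {x y} (xy : Arc (arcs D) x y) where
      x≢y : x ≢ y
      x≢y refl = loopless D x xy

      n∸2≡1+[n∸3] : n ∸ 2 ≡ suc (n ∸ 3)
      n∸2≡1+[n∸3]
        -- For the empty packing the bound reads `3 ≤ n`, so neither subtraction is truncated.
        with s≤s (s≤s (s≤s _)) ← bound-delete xy x≢y (pair∋ˡ x y) (pair∋ʳ x y) packing-empty = refl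

      lambda-delete : IsLambda 2 (D ─ singleArc x y) (n ∸ 3)
      lambda-delete = isLambda
        (λ S ∣S∣≡2 → packing-delete x y (subst (StrongPacking D S) n∸2≡1+[n∸3] (packings S ∣S∣≡2)))
        (⁅ x ⁆ ∪ ⁅ y ⁆) (∣⁅x⁆∪⁅y⁆∣≡2 x y x≢y)
        λ P → ∸-monoˡ-≤ 3 (bound-delete xy x≢y (pair∋ˡ x y) (pair∋ʳ x y) P)

      smaller : n ∸ 3 < n ∸ 2
      smaller = subst (n ∸ 3 <_) (sym n∸2≡1+[n∸3]) (n<1+n (n ∸ 3))

-- The complement of a minimal digraph

module _ {D : Digraph n} (minimal : MinimallyStrongArcConnected 2 (n ∸ 2) D) where

  complement : ArcSet n
  complement = arcs (complete n ─ arcs D)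

  private
    M = complement

    M⇔ : ∀ {x y} → Arc M x y ⇔ (x ≢ y × ¬ Arc (arcs D) x y)
    M⇔ = mk⇔ (λ xy → let a , b = to (delete-arc (complete n) (arcs D)) xy in to complete-arc a , b)
             (λ (a , b) → from (delete-arc (complete n) (arcs D)) (from complete-arc a , b))

    ¬M⇒D : ∀ {x y} → x ≢ y → ¬ Arc M x y → Arc (arcs D) x y
    ¬M⇒D {x} {y} x≢y ¬xy = decidable-stable (T? (arcs D x y)) λ ¬Dxy → ¬xy (from M⇔ (x≢y , ¬Dxy))

    -- The goal is a negation, so a doubly negated packing suffices. The contradiction is with
    -- `n ≤ 2 + (n ∸ 2)`, which holds for every `n`.
    no-small-bound : ∀ {x y} → x ≢ y →
      ¬ (StrongPacking D (⁅ x ⁆ ∪ ⁅ y ⁆) (n ∸ 2) → 3 + (n ∸ 2) ≤ n)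
    no-small-bound {x} {y} x≢y small with (_ , λD , n∸2≤ℓ) ← proj₁ minimal =
      lambda⇒packing λD (∣⁅x⁆∪⁅y⁆∣≡2 x y x≢y) n∸2≤ℓ
        λ P → <-irrefl refl (≤-trans (s≤s (m≤n+m∸n n 2)) (small P))

  complement⊆complete : complement ⊆ᴬ arcs (complete n)
  complement⊆complete x y xy = from complete-arc (proj₁ (to M⇔ xy))

  ≐complement : D ≐ (complete n ─ complement)
  ≐complement x y with x ≟ y | arcs D x y in eq
  ... | yes refl | true  = ⊥-elim (loopless D x (subst T (sym eq) _))
  ... | yes refl | false = refl
  ... | no _     | true  = refl
  ... | no _     | false = refl

  -- Two missing arcs out of, or into, one vertex would leave too few arcs there for `n ∸ 2`
  -- members.
  complement-partialPermutation : PartialPermutation complement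
  complement-partialPermutation = record
    { irreflexive = λ xx → proj₁ (to M⇔ xx) refl
    ; out-unique  = λ {x} {y} {z} xy xz → decidable-stable (y ≟ z) λ y≢z →
        let x≢y , ¬xy = to M⇔ xy ; x≢z , ¬xz = to M⇔ xz
        in no-small-bound x≢y λ P →
             out-bound-3 x≢y (pair∋ˡ x y) (pair∋ʳ x y) P x≢y x≢z y≢z ¬xy ¬xz
    ; in-unique   = λ {x} {y} {z} xz yz → decidable-stable (x ≟ y) λ x≢y →
        let x≢z , ¬xz = to M⇔ xz ; y≢z , ¬yz = to M⇔ yz
        in no-small-bound (x≢z ∘ sym) λ P →
             in-bound-3 (x≢z ∘ sym) (pair∋ˡ z x) (pair∋ʳ z x) P (x≢z ∘ sym) (y≢z ∘ sym) x≢y ¬xz ¬yz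
    }

  open PartialPermutation complement-partialPermutation

  private
    Sink Source : Fin n → Set
    Sink   x = ∀ z → ¬ Arc M x z
    Source y = ∀ z → ¬ Arc M z y

  -- Otherwise adding (x , y) to the complement would keep it a partial
  -- permutation, so D without (x , y) would still have n ∸ 2 disjoint strong subgraphs.
  sink≡source : ∀ {x y} → Sink x → Source y → x ≡ y
  sink≡source {x} {y} sink source = decidable-stable (x ≟ y) λ x≢y →
    -- The pair attaining the minimum for `D` without `(x , y)` admits fewer than `n ∸ 2` members.
    -- That `(x , y)` is an arc of `D` follows from `x` being a sink of the complement.
    let _ , ((_ , ∣S∣≡2 , _ , maximal) , _) , m<n∸2 = proj₂ minimal x y (¬M⇒D x≢y (sink y))
    in <-irrefl refl (≤-trans m<n∸2 (maximal _
         (Routes.packing M⁺ (pp⁺ x≢y) (D ─ singleArc x y) ⇒D⁻ _ ∣S∣≡2)))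
    where
    M⁺ : ArcSet n
    M⁺ s t = M s t ∨ singleArc x y s t

    M⁺⇒ : ∀ {s t} → Arc M⁺ s t → Arc M s t ⊎ (s ≡ x × t ≡ y)
    M⁺⇒ {s} {t} a = [ inj₁ , inj₂ ∘ to singleArc-arc ]′ (to (T-∨ {M s t}) a)

    ⇒D⁻ : ∀ {s t} → s ≢ t → ¬ Arc M⁺ s t → Arc (arcs (D ─ singleArc x y)) s t
    ⇒D⁻ {s} {t} s≢t ¬st = from (delete-arc D (singleArc x y))
      (¬M⇒D s≢t (λ a → ¬st (from (T-∨ {M s t}) (inj₁ a))) , λ a → ¬st (from (T-∨ {M s t}) (inj₂ a)))

    pp⁺ : x ≢ y → PartialPermutation M⁺
    pp⁺ x≢y = record
      { irreflexive = λ {s} a → irr (M⁺⇒ {s} a)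
      ; out-unique  = λ {s} a b → out (M⁺⇒ {s} a) (M⁺⇒ {s} b)
      ; in-unique   = λ {s} {s′} a b → inn (M⁺⇒ {s} a) (M⁺⇒ {s′} b)
      }
      where
      irr : ∀ {s} → ¬ (Arc M s s ⊎ (s ≡ x × s ≡ y))
      irr (inj₁ a)             = irreflexive a
      irr (inj₂ (refl , refl)) = x≢y refl

      out : ∀ {s t t′} → Arc M s t ⊎ (s ≡ x × t ≡ y) → Arc M s t′ ⊎ (s ≡ x × t′ ≡ y) → t ≡ t′
      out (inj₁ a)             (inj₁ b)             = out-unique a b
      out (inj₁ a)             (inj₂ (refl , refl)) = ⊥-elim (sink _ a)
      out (inj₂ (refl , refl)) (inj₁ b)             = ⊥-elim (sink _ b)
      out (inj₂ (_ , refl))    (inj₂ (_ , refl))    = refl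

      inn : ∀ {s s′ t} → Arc M s t ⊎ (s ≡ x × t ≡ y) → Arc M s′ t ⊎ (s′ ≡ x × t ≡ y) → s ≡ s′
      inn (inj₁ a)             (inj₁ b)             = in-unique a b
      inn (inj₁ a)             (inj₂ (refl , refl)) = ⊥-elim (source _ a)
      inn (inj₂ (refl , refl)) (inj₁ b)             = ⊥-elim (source _ b)
      inn (inj₂ (refl , _))    (inj₂ (refl , _))    = refl

  -- If x had a predecessor then every vertex would, and the predecessor map
  -- would be an injection of the vertex set into itself that misses x.
  sink⇒source : ∀ {x} → Sink x → Source x
  sink⇒source {x} sink z zx = <-irrefl refl (avoid-1 (proj₁ ∘ pred) pred-injective
    λ i eq → sink i (subst (λ w → Arc M w i) eq (proj₂ (pred i))))
    where
    pred : ∀ y → ∃[ w ] Arc M w y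
    pred y with any? (λ w → T? (M w y))
    ... | yes w = w
    -- A vertex without predecessors is a source, hence equal to the sink `x`, which has the
    -- predecessor `z`.
    ... | no ¬∃ with refl ← sink≡source sink (λ w wy → ¬∃ (w , wy)) = z , zx

    pred-injective : Injective _≡_ _≡_ (proj₁ ∘ pred)
    pred-injective {i} {j} eq =
      out-unique (subst (λ w → Arc M w i) eq (proj₂ (pred i))) (proj₂ (pred j))

  private
    -- The graph of the permutation that follows `M` and fixes its sinks.
    data Successor (x : Fin n) : Fin n → Set where
      moves : ∀ {y} → Arc M x y → Successor x y
      stays : Sink x → Successor x x

    successor : ∀ x → ∃[ y ] Successor x y
    successor x with any? (λ y → T? (M x y))
    ... | yes (y , xy) = y , moves xy
    ... | no ¬∃        = x , stays λ y xy → ¬∃ (y , xy)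

    f : Fin n → Fin n
    f = proj₁ ∘ successor

    -- A fixed sink is also a source, so no arc of `M` arrives at it.
    successor-unique : ∀ {x y z} → Successor x z → Successor y z → x ≡ y
    successor-unique (moves xz)   (moves yz)   = in-unique xz yz
    successor-unique (moves xz)   (stays sink) = ⊥-elim (sink⇒source sink _ xz)
    successor-unique (stays sink) (moves yz)   = ⊥-elim (sink⇒source sink _ yz)
    successor-unique (stays _)    (stays _)    = refl

    f-injective : Injective _≡_ _≡_ f
    f-injective {x} {y} eq =
      successor-unique (subst (Successor x) eq (proj₂ (successor x))) (proj₂ (successor y))

    M⇒f : ∀ {x y} → Arc M x y → y ≡ f x
    M⇒f {x} xy with successor x
    ... | _ , moves xz   = out-unique xy xz
    ... | _ , stays sink = ⊥-elim (sink _ xy)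

    f⇒M : ∀ {x} → f x ≢ x → Arc M x (f x)
    f⇒M {x} fx≢x with successor x
    ... | _ , moves xz = xz
    ... | _ , stays _  = ⊥-elim (fx≢x refl)

    fixed⇒sink : ∀ {x} → f x ≡ x → Sink x
    fixed⇒sink {x} fx≡x with successor x
    ... | _ , stays sink = sink
    ... | _ , moves xz   = ⊥-elim (irreflexive (subst (Arc M x) fx≡x xz))

  minimal⇒cycleUnion :
    IsAlmostSpanningDisjointCycleUnion (arcInduced (complete n) complement complement⊆complete)
  minimal⇒cycleUnion = function⇒cycleUnion complement⊆complete f f-injective M⇒f f⇒M
    -- Both fixed points are sinks, and the second is then a source too.
    λ fx≡x fy≡y → sink≡source (fixed⇒sink fx≡x) (sink⇒source (fixed⇒sink fy≡y))

theorem5p2 : ∀ (n : ℕ) → 2 ≤ n → (D : Digraph n) →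
    MinimallyStrongArcConnected 2 (n ∸ 2) D ⇔
    (Σ[ M ∈ ArcSet n ] Σ[ M⊆K ∈ M ⊆ᴬ arcs (complete n) ]
    (D ≐ (complete n ─ M) ×
    IsAlmostSpanningDisjointCycleUnion (arcInduced (complete n) M M⊆K)))
theorem5p2 n 2≤n D = mk⇔
  (λ minimal → complement minimal , complement⊆complete minimal ,
               ≐complement minimal , minimal⇒cycleUnion minimal)
  (λ (M , M⊆K , D≐K─M , union) → cycleUnion⇒minimal 2≤n M⊆K D≐K─M union)
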